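{- For every $n\ge 2$ and every $\sigma\in I_n$, the sequence $\Theta^{n-2}(\sigma)$ is fixed by $\Theta$, i.e. $\Theta^{n-1}(\sigma)=\Theta^{n-2}(\sigma)$.
   Context: $I_n$ is the set of inversion sequences of length $n$, i.e. integer sequences $\sigma=(\sigma_1,\ldots,\sigma_n)$ with $0\le\sigma_i<i$ for every $1\le i\le n$. For a finite integer sequence $\sigma$ of length $n$, $\Theta(\sigma)$ is the sequence of length $n$ defined by $\Theta(\sigma)_i=\#\{j<i:\sigma_j<\sigma_i\}$. $\Theta^k$ denotes the $k$-fold iterate of $\Theta$, with $\Theta^0$ the identity. -}

module Defs where

open import Data.Fin as Fin using (Fin; toℕ)
open import Data.Integer as ℤ using (ℤ; +_; 0ℤ)
open import Data.Nat using (ℕ; suc)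
open import Data.Nat.GeneralisedArithmetic using (fold)
open import Data.Product using (_×_)
open import Data.Vec using (Vec; lookup; tabulate; allFin; count)
open import Level using (0ℓ)
open import Relation.Nullary.Decidable using (_×-dec_)
open import Relation.Unary using (Pred)
import Data.Fin.Properties as Fin
import Data.Integer.Properties as ℤ

-- The entry at i : Fin n is the (1 + toℕ i)-th term of the sequence, so the
-- strict upper bound on it is 1 + toℕ i.
I : (n : ℕ) → Pred (Vec ℤ n) 0ℓ
I n σ = (i : Fin n) → 0ℤ ℤ.≤ lookup σ i × lookup σ i ℤ.< + suc (toℕ i)

Θ : {n : ℕ} → Vec ℤ n → Vec ℤ n
Θ {n} σ = tabulate λ i →
  + count (λ j → (j Fin.<? i) ×-dec (lookup σ j ℤ.<? lookup σ i)) (allFin n)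

Θ^ : {n : ℕ} → ℕ → Vec ℤ n → Vec ℤ n
Θ^ k σ = fold σ Θ k

{-# OPTIONS --safe #-}
-- On inversion sequences Θ is pointwise nondecreasing: if j < σᵢ (counting
-- positions from 0) then σⱼ ≤ j < σᵢ, so all of these j are counted by Θ(σ)ᵢ.
-- Hence an entry that Θ leaves unchanged stays unchanged, because the entries
-- before it can only grow.  So an entry that still changes at step k has grown
-- by at least one at every earlier step, and it was not 0 initially; thus it is
-- at least 1 + k, whereas every entry is at most n − 1.
module Submission where

open import Defs
open import Data.Bool using (true; false)
open import Data.Fin as Fin using (Fin; toℕ)
open import Data.Integer using (ℤ; +_; 0ℤ; +≤+; +<+)
open import Data.Nat using (ℕ; zero; suc; _∸_; _≤_; z≤n; s≤s; s<s; s<s⁻¹)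
open import Data.Product using (_×_; _,_; proj₁; proj₂)
open import Data.Sum using (_⊎_; inj₁; inj₂)
open import Data.Vec using (Vec; []; _∷_; lookup; tabulate; allFin; map; count)
open import Data.Vec.Properties
  using (lookup∘tabulate; tabulate∘lookup; tabulate-cong; tabulate-allFin)
open import Function using (_∘_)
open import Level using (Level)
open import Relation.Binary.PropositionalEquality
  using (_≡_; _≗_; refl; sym; trans; cong; module ≡-Reasoning)
open import Relation.Nullary using (yes; no; does; contradiction)
open import Relation.Nullary.Decidable using (_×-dec_)
open import Relation.Unary using (Pred; Decidable; _∈_; _⊆_)
import Data.Fin.Properties as Fin
import Data.Integer as ℤ
import Data.Integer.Properties as ℤ
import Data.Nat as ℕ
import Data.Nat.Properties as ℕ

private
  variable
    a b p q : Level
    A : Set a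
    B : Set b
    n : ℕ

count-mono : {P : Pred A p} {Q : Pred A q} (P? : Decidable P) (Q? : Decidable Q) →
             P ⊆ Q → (xs : Vec A n) → count P? xs ≤ count Q? xs
count-mono P? Q? P⊆Q [] = z≤n
count-mono P? Q? P⊆Q (x ∷ xs) with P? x | Q? x
... | yes _  | yes _  = s≤s (count-mono P? Q? P⊆Q xs)
... | yes px | no ¬qx = contradiction (P⊆Q px) ¬qx
... | no _   | yes _  = ℕ.m≤n⇒m≤1+n (count-mono P? Q? P⊆Q xs)
... | no _   | no _   = count-mono P? Q? P⊆Q xs

count-cong : {P : Pred A p} {Q : Pred A q} (P? : Decidable P) (Q? : Decidable Q) →
             P ⊆ Q → Q ⊆ P → (xs : Vec A n) → count P? xs ≡ count Q? xs
count-cong P? Q? P⊆Q Q⊆P xs =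
  ℕ.≤-antisym (count-mono P? Q? P⊆Q xs) (count-mono Q? P? Q⊆P xs)

count-map : {P : Pred B p} (P? : Decidable P) (f : A → B) (xs : Vec A n) →
            count P? (map f xs) ≡ count (P? ∘ f) xs
count-map P? f [] = refl
count-map P? f (x ∷ xs) with does (P? (f x))
... | true  = cong suc (count-map P? f xs)
... | false = count-map P? f xs

-- After its head, `allFin (suc n)` continues as `tabulate Fin.suc`; moving the shift into the
-- predicate makes induction on `n` possible.
count-tabulate : {P : Pred A p} (P? : Decidable P) (f : Fin n → A) →
                 count P? (tabulate f) ≡ count (P? ∘ f) (allFin n)
count-tabulate P? f = trans (cong (count P?) (tabulate-allFin f)) (count-map P? f (allFin _))

toℕ<? : (m : ℕ) → Decidable (λ (j : Fin n) → toℕ j ℕ.< m)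
toℕ<? m j = toℕ j ℕ.<? m

-- Initial segments serve as the yardstick: the bounds on entries of `Θ σ` compare the counted
-- positions with those below some `m`.
count-toℕ< : ∀ {m} → m ≤ n → count (toℕ<? m) (allFin n) ≡ m
count-toℕ< {n = zero}  {m = zero}  z≤n       = refl
count-toℕ< {n = suc n} {m = zero}  z≤n       = begin
  count (toℕ<? 0) (tabulate (Fin.suc {n}))   ≡⟨ count-tabulate (toℕ<? 0) (Fin.suc {n}) ⟩
  count (toℕ<? 0 ∘ Fin.suc) (allFin n)       ≡⟨ count-cong (toℕ<? 0 ∘ Fin.suc) (toℕ<? 0) (λ ()) (λ ()) (allFin n) ⟩
  count (toℕ<? 0) (allFin n)                 ≡⟨ count-toℕ< {n} z≤n ⟩
  0                                          ∎
  where open ≡-Reasoning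
count-toℕ< {n = suc n} {m = suc m} (s≤s m≤n) = cong suc (begin
  count (toℕ<? (suc m)) (tabulate (Fin.suc {n}))   ≡⟨ count-tabulate (toℕ<? (suc m)) (Fin.suc {n}) ⟩
  count (toℕ<? (suc m) ∘ Fin.suc) (allFin n)       ≡⟨ count-cong (toℕ<? (suc m) ∘ Fin.suc) (toℕ<? m) s<s⁻¹ s<s (allFin n) ⟩
  count (toℕ<? m) (allFin n)                       ≡⟨ count-toℕ< m≤n ⟩
  m                                                ∎)
  where open ≡-Reasoning

smaller? : (σ : Vec ℤ n) (i : Fin n) →
           Decidable (λ j → j Fin.< i × lookup σ j ℤ.< lookup σ i)
smaller? σ i j = (j Fin.<? i) ×-dec (lookup σ j ℤ.<? lookup σ i)

lookup-Θ : (σ : Vec ℤ n) (i : Fin n) → lookup (Θ σ) i ≡ + count (smaller? σ i) (allFin n)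
lookup-Θ σ i = lookup∘tabulate _ i

-- Only positions before `i` are counted, and there are `toℕ i` of them.
Θ-upper : (σ : Vec ℤ n) (i : Fin n) → lookup (Θ σ) i ℤ.≤ + toℕ i
Θ-upper {n} σ i rewrite lookup-Θ σ i = +≤+ (ℕ.≤-trans
  (count-mono (smaller? σ i) (toℕ<? (toℕ i)) proj₁ (allFin n))
  (ℕ.≤-reflexive (count-toℕ< (ℕ.<⇒≤ (Fin.toℕ<n i)))))

Θ-lower : (σ : Vec ℤ n) (i : Fin n) → 0ℤ ℤ.≤ lookup (Θ σ) i
Θ-lower σ i rewrite lookup-Θ σ i = +≤+ z≤n

I-upper : (σ : Vec ℤ n) → σ ∈ I n → ∀ i → lookup σ i ℤ.≤ + toℕ i
I-upper σ σ∈I i = ℤ.i<j⇒i≤pred[j] (proj₂ (σ∈I i))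

Θ∈I : (σ : Vec ℤ n) → Θ σ ∈ I n
Θ∈I σ i = Θ-lower σ i , ℤ.≤-<-trans (Θ-upper σ i) (+<+ (ℕ.n<1+n _))

Θ-increases : (σ : Vec ℤ n) → σ ∈ I n → ∀ i → lookup σ i ℤ.≤ lookup (Θ σ) i
Θ-increases {n} σ σ∈I i rewrite lookup-Θ σ i
  -- Nonnegativity leaves only the case `+ m`, and abstracting `lookup σ i` also puts `+ m` into the
  -- counted predicate.
  with lookup σ i in σᵢ≡m | proj₁ (σ∈I i) | I-upper σ σ∈I i
... | + m | _ | +≤+ m≤i = +≤+ (ℕ.≤-trans
  (ℕ.≤-reflexive (sym (count-toℕ< (ℕ.≤-trans m≤i (ℕ.<⇒≤ (Fin.toℕ<n i))))))
  (count-mono (toℕ<? m) (λ j → (j Fin.<? i) ×-dec (lookup σ j ℤ.<? + m))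
    (λ {j} j<m → ℕ.<-≤-trans j<m m≤i , ℤ.≤-<-trans (I-upper σ σ∈I j) (+<+ j<m))
    (allFin n)))

-- No term lies below 0, so the count is empty. This starts the later induction: an entry that
-- changes at the first step is at least 1.
Θ-fixes-0 : (σ : Vec ℤ n) → σ ∈ I n → ∀ i → lookup σ i ≡ 0ℤ → lookup (Θ σ) i ≡ lookup σ i
Θ-fixes-0 {n} σ σ∈I i σᵢ≡0 = trans (lookup-Θ σ i) (trans (cong +_ (ℕ.n≤0⇒n≡0 (ℕ.≤-trans
  (count-mono (smaller? σ i) (toℕ<? 0)
    (λ {j} (_ , σⱼ<σᵢ) → contradiction
      (ℤ.≤-<-trans (proj₁ (σ∈I j)) (ℤ.<-≤-trans σⱼ<σᵢ (ℤ.≤-reflexive σᵢ≡0)))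
      (ℤ.<-irrefl refl))
    (allFin n))
  (ℕ.≤-reflexive (count-toℕ< {n = n} z≤n))))) (sym σᵢ≡0))

-- A position `j` in the second count has σⱼ ≤ Θ(σ)ⱼ < Θ(σ)ᵢ = σᵢ, so it is in the first count too,
-- and the entry cannot grow. It cannot drop either, by `Θ-increases`.
unchanged-stays-unchanged : (σ : Vec ℤ n) → σ ∈ I n → ∀ i → lookup (Θ σ) i ≡ lookup σ i →
                            lookup (Θ (Θ σ)) i ≡ lookup (Θ σ) i
unchanged-stays-unchanged {n} σ σ∈I i Θσᵢ≡σᵢ = ℤ.≤-antisym
  (begin
    lookup (Θ (Θ σ)) i                      ≡⟨ lookup-Θ (Θ σ) i ⟩
    + count (smaller? (Θ σ) i) (allFin n)   ≤⟨ +≤+ (count-mono (smaller? (Θ σ) i) (smaller? σ i) smaller (allFin n)) ⟩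
    + count (smaller? σ i) (allFin n)       ≡⟨ lookup-Θ σ i ⟨
    lookup (Θ σ) i                          ∎)
  (Θ-increases (Θ σ) (Θ∈I σ) i)
  where
  open ℤ.≤-Reasoning
  smaller : ∀ {j} → j Fin.< i × lookup (Θ σ) j ℤ.< lookup (Θ σ) i →
            j Fin.< i × lookup σ j ℤ.< lookup σ i
  smaller {j} (j<i , Θσⱼ<Θσᵢ) =
    j<i , ℤ.≤-<-trans (Θ-increases σ σ∈I j) (ℤ.<-≤-trans Θσⱼ<Θσᵢ (ℤ.≤-reflexive Θσᵢ≡σᵢ))

Θ^-preserves-I : (k : ℕ) (σ : Vec ℤ n) → σ ∈ I n → Θ^ k σ ∈ I n
Θ^-preserves-I zero    σ σ∈I = σ∈I
Θ^-preserves-I (suc k) σ σ∈I = Θ∈I (Θ^ k σ)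

-- Induction on `k`: an entry that changes now also changed one step earlier, so it met the previous
-- bound then and has strictly grown since. The bound is `suc k` rather than `k` because zeros never
-- move; this is what allows the exponent n - 2.
unchanged-or-large : (k : ℕ) (σ : Vec ℤ n) → σ ∈ I n → ∀ i →
                     lookup (Θ^ (suc k) σ) i ≡ lookup (Θ^ k σ) i ⊎ + suc k ℤ.≤ lookup (Θ^ k σ) i
unchanged-or-large zero σ σ∈I i with lookup σ i ℤ.≟ 0ℤ
... | yes σᵢ≡0 = inj₁ (Θ-fixes-0 σ σ∈I i σᵢ≡0)
... | no  σᵢ≢0 = inj₂ (ℤ.i<j⇒suc[i]≤j (ℤ.≤∧≢⇒< (proj₁ (σ∈I i)) (σᵢ≢0 ∘ sym)))
unchanged-or-large (suc k) σ σ∈I i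
  with lookup (Θ^ (suc k) σ) i ℤ.≟ lookup (Θ^ k σ) i | unchanged-or-large k σ σ∈I i
... | yes eq | _         = inj₁ (unchanged-stays-unchanged (Θ^ k σ) (Θ^-preserves-I k σ σ∈I) i eq)
... | no neq | inj₁ eq   = contradiction eq neq
... | no neq | inj₂ 1+k≤ = inj₂ (ℤ.i<j⇒suc[i]≤j (ℤ.≤-<-trans 1+k≤
  (ℤ.≤∧≢⇒< (Θ-increases (Θ^ k σ) (Θ^-preserves-I k σ σ∈I) i) (neq ∘ sym))))

lookup-injective : {xs ys : Vec A n} → lookup xs ≗ lookup ys → xs ≡ ys
lookup-injective {xs = xs} {ys} eq =
  trans (sym (tabulate∘lookup xs)) (trans (tabulate-cong eq) (tabulate∘lookup ys))

proposition3p5 : (n : ℕ) → 2 ≤ n → (σ : Vec ℤ n) → σ ∈ I n → Θ^ (n ∸ 1) σ ≡ Θ^ (n ∸ 2) σ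
proposition3p5 (suc (suc k)) (s≤s (s≤s z≤n)) σ σ∈I = lookup-injective unchanged
  where
  unchanged : lookup (Θ^ (suc k) σ) ≗ lookup (Θ^ k σ)
  unchanged i with unchanged-or-large k σ σ∈I i
  ... | inj₁ eq   = eq
  -- Here `n` is `suc (suc k)`, so `suc k` is the last position counted from 0 and no entry of
  -- `Θ^ (suc k) σ` exceeds it; an entry already that large cannot grow.
  ... | inj₂ 1+k≤ = ℤ.≤-antisym
    (ℤ.≤-trans (Θ-upper (Θ^ k σ) i) (ℤ.≤-trans (+≤+ (Fin.toℕ≤pred[n] i)) 1+k≤))
    (Θ-increases (Θ^ k σ) (Θ^-preserves-I k σ σ∈I) i)
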